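{- Fix $n\in\mathbb{N}$. (1) The number of subsets of $\{1,2,\ldots,n\}$ that contain $n$ and whose difference sets contain only odd numbers is $F_{n+1}$. (2) The number of subsets of $\{1,2,\ldots,n\}$ whose difference sets contain only odd numbers is $F_{n+3}-1$. Here the empty set and sets with exactly one element are regarded as vacuously satisfying the requirement that the difference set contain only odd numbers.
   Context: $\mathbb{N}=\{1,2,3,\ldots\}$. For a set $A=\{a_1,a_2,\ldots,a_k\}$ of natural numbers with $a_1<a_2<\cdots<a_k$ and $k\ge 2$, the difference set of $A$ is $\{a_2-a_1,a_3-a_2,\ldots,a_k-a_{k-1}\}$ (differences of consecutive elements only). The empty set and a set with exactly one element do not have a difference set. The Fibonacci sequence is defined by $F_{ -1}=1$, $F_0=0$, and $F_m=F_{m-1}+F_{m-2}$ for all $m\ge 1$. -}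

module Defs where

open import Data.Fin.Base using (toℕ)
open import Data.Fin.Subset using (Subset)
open import Data.Fin.Subset.Properties using (_∈?_)
open import Data.List.Base using (List; []; _∷_; allFin; filter; length; map)
open import Data.List.Membership.Propositional using (_∈_)
open import Data.List.Relation.Unary.Unique.Propositional using (Unique)
open import Data.Nat.Base using (ℕ; zero; suc; _+_; _*_; _∸_)
open import Data.Product.Base using (∃-syntax; _×_)
open import Function.Bundles using (_⇔_)
open import Level using (Level)
open import Relation.Binary.PropositionalEquality.Core using (_≡_)
open import Relation.Unary using (Pred; _⊆_)

private
  variable
    a ℓ : Level

-- The sequence F₋₁, F₀, F₁, …: the k-th value is F_{k-1}.
fibFrom-1 : ℕ → ℕ
fibFrom-1 zero          = 1
fibFrom-1 (suc zero)    = 0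
fibFrom-1 (suc (suc k)) = fibFrom-1 (suc k) + fibFrom-1 k

F : ℕ → ℕ
F m = fibFrom-1 (suc m)

Odd : Pred ℕ _
Odd d = ∃[ k ] d ≡ 2 * k + 1

-- A : Subset n stands for a subset of {1, …, n}: the index i : Fin n
-- represents the number toℕ i + 1.  The result is a₁ < a₂ < ⋯ < aₖ.
elements : ∀ {n} → Subset n → List ℕ
elements {n} A = map (λ i → suc (toℕ i)) (filter (_∈? A) (allFin n))

-- Only applied to increasing lists, so the subtraction never truncates.
consecutiveDifferences : List ℕ → List ℕ
consecutiveDifferences []             = []
consecutiveDifferences (_ ∷ [])       = []
consecutiveDifferences (x ∷ (y ∷ zs)) = (y ∸ x) ∷ consecutiveDifferences (y ∷ zs)

-- A set with fewer than two elements has no difference set; here it gets the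
-- empty one, so that any condition on all differences holds vacuously.
DifferenceSet : ∀ {n} → Subset n → Pred ℕ _
DifferenceSet A d = d ∈ consecutiveDifferences (elements A)

OnlyOddDifferences : ∀ {n} → Pred (Subset n) _
OnlyOddDifferences A = DifferenceSet A ⊆ Odd

-- P holds of exactly k elements of X.
HasCardinality : {X : Set a} → Pred X ℓ → ℕ → Set _
HasCardinality {X = X} P k =
  ∃[ xs ] Unique xs × (∀ (x : X) → x ∈ xs ⇔ P x) × length xs ≡ k

{-# OPTIONS --safe #-}

-- Split the subsets of {1, …, n} according to whether they contain n, and count,
-- for d = 1 and d = 2, those that still have only odd differences after n + d is
-- adjoined.  Containing n forces d to be odd; otherwise d becomes d + 1 over
-- {1, …, n - 1}, and only its parity matters.  So the two counts satisfy the
-- Fibonacci recurrence.  A set counted in (2) either contains n, which is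
-- the case d = 1 over {1, …, n - 1}, or is a set counted in (2) for n - 1.
module Submission where

open import Defs
open import Data.Bool.Base using (true; false)
open import Data.Fin.Base as Fin using (toℕ)
open import Data.Fin.Properties using (toℕ<n)
open import Data.Fin.Subset using (Subset)
open import Data.Fin.Subset.Properties using (_∈?_; drop-there)
open import Data.List.Base using (List; []; _∷_; _∷ʳ_; _++_; allFin; filter; map; tabulate)
open import Data.List.Membership.Propositional using (_∈_; _∉_)
open import Data.List.Membership.Propositional.Properties
  using (∈-map⁺; ∈-map⁻; ∈-++⁺ˡ; ∈-++⁺ʳ; ∈-++⁻)
open import Data.List.Properties
  using (++-assoc; filter-≐; length-++; length-map; map-++; map-∘; map-tabulate)
open import Data.List.Relation.Unary.All as All using (All; []; _∷_)
import Data.List.Relation.Unary.All.Properties as All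
open import Data.List.Relation.Unary.AllPairs using ([]; _∷_)
open import Data.List.Relation.Unary.Any using (here)
import Data.List.Relation.Unary.Unique.Propositional.Properties as Unique
open import Data.Nat.Base using (ℕ; zero; suc; NonZero; _+_; _∸_; _≤_; s≤s; z≤n)
open import Data.Nat.Properties
  using (*-suc; +-∸-assoc; +-comm; <-irrefl; m+n∸n≡m; m≤n⇒m≤1+n; m≤n⇒m≤n+o; suc-injective)
open import Data.Product.Base using (_×_; _,_; proj₁; proj₂)
open import Data.Sum.Base using (inj₁; inj₂)
open import Data.Vec.Base as Vec using (Vec; []; _∷_)
import Data.Vec.Properties as Vec
open import Function.Base using (_∘_; id)
open import Function.Bundles using (_⇔_; mk⇔; Equivalence)
import Function.Construct.Composition as Compose
open import Function.Construct.Identity using (⇔-id)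
open import Level using (Level)
open import Relation.Binary.PropositionalEquality
  using (_≡_; refl; sym; trans; cong; cong₂; subst; module ≡-Reasoning)
open import Relation.Nullary.Decidable.Core using (does)
open import Relation.Nullary.Negation.Core using (¬_; contradiction)
open import Relation.Unary using (Pred; Decidable)

open Equivalence using (to; from)

private
  variable
    a b ℓ ℓ′ : Level
    A : Set a
    B : Set b
    k m n : ℕ

-- Cardinalities of predicates.

card-cong : {P : Pred A ℓ} {Q : Pred A ℓ′} →
            (∀ x → P x ⇔ Q x) → HasCardinality Q k → HasCardinality P k
card-cong P⇔Q (xs , uniq , xs⇔Q , len) =
  xs , uniq
     , (λ x → mk⇔ (from (P⇔Q x) ∘ to (xs⇔Q x)) (from (xs⇔Q x) ∘ to (P⇔Q x)))
     , len

card-none : {P : Pred A ℓ} → (∀ x → ¬ P x) → HasCardinality P 0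
card-none ¬P = [] , [] , (λ x → mk⇔ (λ ()) (λ p → contradiction p (¬P x))) , refl

card-[] : {P : Pred (Vec A 0) ℓ} → P [] → HasCardinality P 1
card-[] p = [] ∷ [] , [] ∷ [] , (λ where [] → mk⇔ (λ _ → p) (λ _ → here refl)) , refl

-- The last entry records whether the largest number belongs to the set. The two enumerations,
-- extended by `true` and by `false`, cannot overlap because their last entries differ.
card-∷ʳ : {P : Pred (Subset (suc n)) ℓ} →
          HasCardinality (P ∘ (Vec._∷ʳ true)) k →
          HasCardinality (P ∘ (Vec._∷ʳ false)) m →
          HasCardinality P (k + m)
card-∷ʳ {n = n} {P = P} (xs , xs! , xs⇔P , refl) (ys , ys! , ys⇔P , refl) =
  map (Vec._∷ʳ true) xs ++ map (Vec._∷ʳ false) ys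
  , Unique.++⁺ (Unique.map⁺ (Vec.∷ʳ-injectiveˡ _ _) xs!)
               (Unique.map⁺ (Vec.∷ʳ-injectiveˡ _ _) ys!)
               disjoint
  , (λ S → mk⇔ sound (complete S))
  , trans (length-++ (map _ xs)) (cong₂ _+_ (length-map _ xs) (length-map _ ys))
  where
  disjoint : ∀ {S : Subset (suc n)} →
             ¬ (S ∈ map (Vec._∷ʳ true) xs × S ∈ map (Vec._∷ʳ false) ys)
  disjoint (p , q) with ∈-map⁻ _ p | ∈-map⁻ _ q
  ... | S , _ , refl | T , _ , eq with () ← Vec.∷ʳ-injectiveʳ S T eq

  sound : ∀ {S} → S ∈ map (Vec._∷ʳ true) xs ++ map (Vec._∷ʳ false) ys → P S
  sound p with ∈-++⁻ (map _ xs) p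
  ... | inj₁ q with S , S∈xs , refl ← ∈-map⁻ _ q = to (xs⇔P S) S∈xs
  ... | inj₂ q with S , S∈ys , refl ← ∈-map⁻ _ q = to (ys⇔P S) S∈ys

  complete : ∀ S → P S → S ∈ map (Vec._∷ʳ true) xs ++ map (Vec._∷ʳ false) ys
  complete S p with Vec.initLast S
  ... | T , true  , refl = ∈-++⁺ˡ (∈-map⁺ _ (from (xs⇔P T) p))
  ... | T , false , refl = ∈-++⁺ʳ (map _ xs) (∈-map⁺ _ (from (ys⇔P T) p))

-- Elements of an extended subset.

filter-map : {P : Pred B ℓ} (P? : Decidable P) (f : A → B) (xs : List A) →
             filter P? (map f xs) ≡ map f (filter (P? ∘ f) xs)
filter-map P? f [] = refl
filter-map P? f (x ∷ xs) with does (P? (f x))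
... | true  = cong (f x ∷_) (filter-map P? f xs)
... | false = filter-map P? f xs

elements-tail : ∀ s (S : Subset n) →
  map (suc ∘ toℕ) (filter (_∈? (s ∷ S)) (tabulate Fin.suc)) ≡ map suc (elements S)
elements-tail {n} s S = begin
  map (suc ∘ toℕ) (filter (_∈? (s ∷ S)) (tabulate Fin.suc))
    ≡⟨ cong (map (suc ∘ toℕ) ∘ filter (_∈? (s ∷ S))) (map-tabulate id Fin.suc) ⟨
  map (suc ∘ toℕ) (filter (_∈? (s ∷ S)) (map Fin.suc (allFin n)))
    ≡⟨ cong (map (suc ∘ toℕ)) (filter-map (_∈? (s ∷ S)) Fin.suc (allFin n)) ⟩
  map (suc ∘ toℕ) (map Fin.suc (filter ((_∈? (s ∷ S)) ∘ Fin.suc) (allFin n)))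
    ≡⟨ cong (map (suc ∘ toℕ) ∘ map Fin.suc) (filter-≐ _ (_∈? S) (drop-there , Vec.there) (allFin n)) ⟩
  map (suc ∘ toℕ) (map Fin.suc (filter (_∈? S) (allFin n)))
    ≡⟨ map-∘ _ ⟨
  map (suc ∘ suc ∘ toℕ) (filter (_∈? S) (allFin n))
    ≡⟨ map-∘ _ ⟩
  map suc (elements S) ∎
  where open ≡-Reasoning

elements-∷ : ∀ s (S : Subset n) → elements (s ∷ S) ≡ elements (s ∷ []) ++ map suc (elements S)
elements-∷ true  S = cong (1 ∷_) (elements-tail true S)
elements-∷ false S = elements-tail false S

-- `elements` runs through the indices from the front, while the counting splits on the last entry.
-- The induction therefore peels off the first entry, which shifts the later elements by one.
elements-∷ʳ-true : (S : Subset n) → elements (S Vec.∷ʳ true) ≡ elements S ∷ʳ suc n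
elements-∷ʳ-true [] = refl
elements-∷ʳ-true {suc n} (s ∷ S) = begin
  elements (s ∷ (S Vec.∷ʳ true))
    ≡⟨ elements-∷ s (S Vec.∷ʳ true) ⟩
  elements (s ∷ []) ++ map suc (elements (S Vec.∷ʳ true))
    ≡⟨ cong (λ xs → elements (s ∷ []) ++ map suc xs) (elements-∷ʳ-true S) ⟩
  elements (s ∷ []) ++ map suc (elements S ∷ʳ suc n)
    ≡⟨ cong (elements (s ∷ []) ++_) (map-++ suc (elements S) _) ⟩
  elements (s ∷ []) ++ (map suc (elements S) ∷ʳ suc (suc n))
    ≡⟨ ++-assoc (elements (s ∷ [])) _ _ ⟨
  (elements (s ∷ []) ++ map suc (elements S)) ∷ʳ suc (suc n)
    ≡⟨ cong (_∷ʳ suc (suc n)) (elements-∷ s S) ⟨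
  elements (s ∷ S) ∷ʳ suc (suc n) ∎
  where open ≡-Reasoning

elements-∷ʳ-false : (S : Subset n) → elements (S Vec.∷ʳ false) ≡ elements S
elements-∷ʳ-false [] = refl
elements-∷ʳ-false (s ∷ S) = begin
  elements (s ∷ (S Vec.∷ʳ false))
    ≡⟨ elements-∷ s (S Vec.∷ʳ false) ⟩
  elements (s ∷ []) ++ map suc (elements (S Vec.∷ʳ false))
    ≡⟨ cong (λ xs → elements (s ∷ []) ++ map suc xs) (elements-∷ʳ-false S) ⟩
  elements (s ∷ []) ++ map suc (elements S)
    ≡⟨ elements-∷ s S ⟨
  elements (s ∷ S) ∎
  where open ≡-Reasoning

elements≤n : (S : Subset n) → All (_≤ n) (elements S)
elements≤n S = All.map⁺ (All.universal toℕ<n _)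

suc-n∉elements : (S : Subset n) → suc n ∉ elements S
suc-n∉elements S p = <-irrefl refl (All.lookup (elements≤n S) p)

-- Parity of differences when a number is appended.

Odd-2+ : ∀ d → Odd (2 + d) ⇔ Odd d
Odd-2+ d = mk⇔ dec inc
  where
  dec : Odd (2 + d) → Odd d
  -- The witness 0 would give `2 + d` equal to 1, so that case is empty.
  dec (suc k , eq) =
    k , suc-injective (suc-injective (trans eq (cong (_+ 1) (*-suc 2 k))))
  inc : Odd d → Odd (2 + d)
  inc (k , eq) = suc k , trans (cong (2 +_) eq) (sym (cong (_+ 1) (*-suc 2 k)))

1-odd : Odd 1
1-odd = 0 , refl

2-not-odd : ¬ Odd 2
2-not-odd odd with to (Odd-2+ 0) odd
... | zero  , ()
... | suc _ , ()

OddGaps : Pred (List ℕ) _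
OddGaps xs = All Odd (consecutiveDifferences xs)

consecutiveDifferences-∷ʳ : ∀ xs x y →
  consecutiveDifferences (xs ∷ʳ x ∷ʳ y) ≡ consecutiveDifferences (xs ∷ʳ x) ∷ʳ (y ∸ x)
consecutiveDifferences-∷ʳ []           x y = refl
consecutiveDifferences-∷ʳ (_ ∷ [])     x y = refl
consecutiveDifferences-∷ʳ (_ ∷ z ∷ xs) x y =
  cong (_ ∷_) (consecutiveDifferences-∷ʳ (z ∷ xs) x y)

OddGaps-∷ʳ : ∀ xs x d →
  OddGaps (xs ∷ʳ x ∷ʳ (d + x)) ⇔ (OddGaps (xs ∷ʳ x) × Odd d)
OddGaps-∷ʳ xs x d
  rewrite consecutiveDifferences-∷ʳ xs x (d + x) | m+n∸n≡m d x =
  mk⇔ All.∷ʳ⁻ (λ (ps , p) → All.∷ʳ⁺ ps p)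

-- Only the last difference involves the appended number, and it changes by 2. The bound on `xs`
-- keeps the subtraction from truncating, so that `(2 + y) ∸ x` is `2 + (y ∸ x)`.
OddGaps-parity : ∀ xs {y} → All (_≤ y) xs → OddGaps (xs ∷ʳ (2 + y)) ⇔ OddGaps (xs ∷ʳ y)
OddGaps-parity []           _           = ⇔-id _
OddGaps-parity (x ∷ []) {y} (x≤y ∷ []) rewrite +-∸-assoc 2 x≤y =
  mk⇔ (λ where (p ∷ []) → to   (Odd-2+ (y ∸ x)) p ∷ [])
      (λ where (p ∷ []) → from (Odd-2+ (y ∸ x)) p ∷ [])
OddGaps-parity (_ ∷ z ∷ zs) (_ ∷ zs≤y) =
  mk⇔ (λ where (p ∷ ps) → p ∷ to   tail ps)
      (λ where (p ∷ ps) → p ∷ from tail ps)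
  where tail = OddGaps-parity (z ∷ zs) zs≤y

-- Counting with a further number adjoined.

OddGapsUpTo : ℕ → Pred (Subset n) _
OddGapsUpTo {n} d S = OddGaps (elements S ∷ʳ (d + n))

≡⇒OddGaps⇔ : ∀ {xs ys} → xs ≡ ys → OddGaps xs ⇔ OddGaps ys
≡⇒OddGaps⇔ refl = ⇔-id _

-- The adjoined `d + suc n` directly follows the element `suc n`, so the last difference is `d`. The
-- other differences are those of `S` with `suc n`, that is `1 + n`, adjoined.
UpTo-true : ∀ d (S : Subset n) →
            OddGapsUpTo d (S Vec.∷ʳ true) ⇔ (OddGapsUpTo 1 S × Odd d)
UpTo-true d S = Compose.equivalence
  (≡⇒OddGaps⇔ (cong (_∷ʳ _) (elements-∷ʳ-true S)))
  (OddGaps-∷ʳ (elements S) _ d)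

-- The adjoined number stays the same: `1 + suc n` and `2 + n` agree by computation.
UpTo1-false : (S : Subset n) → OddGapsUpTo 1 (S Vec.∷ʳ false) ⇔ OddGapsUpTo 2 S
UpTo1-false S = ≡⇒OddGaps⇔ (cong (_∷ʳ _) (elements-∷ʳ-false S))

UpTo2-false : (S : Subset n) → OddGapsUpTo 2 (S Vec.∷ʳ false) ⇔ OddGapsUpTo 1 S
UpTo2-false S = Compose.equivalence
  (≡⇒OddGaps⇔ (cong (_∷ʳ _) (elements-∷ʳ-false S)))
  (OddGaps-parity _ (All.map m≤n⇒m≤1+n (elements≤n S)))

-- Mutual induction. Splitting on the largest number gives `F (2 + n) + F (1 + n)` for `d = 1` and
-- `0 + F (2 + n)` for `d = 2`; both compute to the required value. For `n = 0` the only set is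
-- empty, and the adjoined number alone has no differences.
card-UpTo1 : ∀ n → HasCardinality (OddGapsUpTo {n} 1) (F (2 + n))
card-UpTo2 : ∀ n → HasCardinality (OddGapsUpTo {n} 2) (F (1 + n))

card-UpTo1 zero    = card-[] []
card-UpTo1 (suc n) = card-∷ʳ
  (card-cong (λ S → Compose.equivalence (UpTo-true 1 S) (mk⇔ proj₁ (_, 1-odd)))
             (card-UpTo1 n))
  (card-cong UpTo1-false (card-UpTo2 n))

card-UpTo2 zero    = card-[] []
card-UpTo2 (suc n) = card-∷ʳ
  (card-none (λ S p → 2-not-odd (proj₂ (to (UpTo-true 2 S) p))))
  (card-cong UpTo2-false (card-UpTo1 n))

-- Counting the difference sets themselves.

OnlyOdd⇔OddGaps : (S : Subset n) → OnlyOddDifferences S ⇔ OddGaps (elements S)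
OnlyOdd⇔OddGaps S = mk⇔ {A = OnlyOddDifferences S} All.tabulate All.lookup

OnlyOdd-true : (S : Subset n) → OnlyOddDifferences (S Vec.∷ʳ true) ⇔ OddGapsUpTo 1 S
OnlyOdd-true S = Compose.equivalence
  (OnlyOdd⇔OddGaps (S Vec.∷ʳ true)) (≡⇒OddGaps⇔ (elements-∷ʳ-true S))

OnlyOdd-false : (S : Subset n) → OnlyOddDifferences (S Vec.∷ʳ false) ⇔ OnlyOddDifferences S
OnlyOdd-false S rewrite elements-∷ʳ-false S = ⇔-id _

n∈elements-∷ʳ-true : (S : Subset n) → suc n ∈ elements (S Vec.∷ʳ true)
n∈elements-∷ʳ-true S rewrite elements-∷ʳ-true S = ∈-++⁺ʳ (elements S) (here refl)

n∉elements-∷ʳ-false : (S : Subset n) → suc n ∉ elements (S Vec.∷ʳ false)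
n∉elements-∷ʳ-false S rewrite elements-∷ʳ-false S = suc-n∉elements S

-- Ensures that the `∸ 1` in the second count never truncates.
F-suc-positive : ∀ m → 1 ≤ F (suc m)
F-suc-positive zero    = s≤s z≤n
F-suc-positive (suc m) = m≤n⇒m≤n+o (F m) (F-suc-positive m)

card-containing-n : ∀ n →
  HasCardinality (λ (S : Subset (suc n)) → suc n ∈ elements S × OnlyOddDifferences S)
                 (F (2 + n))
-- The split yields `F (2 + n) + 0`; commuted, the sum computes to `F (2 + n)`.
card-containing-n n = subst (HasCardinality _) (+-comm (F (2 + n)) 0) (card-∷ʳ
  (card-cong (λ S → mk⇔ (to (OnlyOdd-true S) ∘ proj₂)
                        (λ p → n∈elements-∷ʳ-true S , from (OnlyOdd-true S) p))
             (card-UpTo1 n))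
  (card-none (λ S p → n∉elements-∷ʳ-false S (proj₁ p))))

card-OnlyOdd : ∀ n → HasCardinality (OnlyOddDifferences {n}) (F (3 + n) ∸ 1)
-- The empty set alone: `F 3 ∸ 1` computes to 1.
card-OnlyOdd zero    = card-[] (λ ())
card-OnlyOdd (suc n) = subst (HasCardinality _) recurrence (card-∷ʳ
  (card-cong OnlyOdd-true (card-UpTo1 n))
  (card-cong OnlyOdd-false (card-OnlyOdd n)))
  where
  recurrence : F (2 + n) + (F (3 + n) ∸ 1) ≡ F (4 + n) ∸ 1
  recurrence = trans (sym (+-∸-assoc (F (2 + n)) (F-suc-positive (2 + n))))
                     (cong (_∸ 1) (+-comm (F (2 + n)) (F (3 + n))))

theorem8 : (n : ℕ) → .{{_ : NonZero n}} →
    HasCardinality (λ (A : Subset n) → n ∈ elements A × OnlyOddDifferences A) (F (n + 1))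
    × HasCardinality (λ (A : Subset n) → OnlyOddDifferences A) (F (n + 3) ∸ 1)
theorem8 n@(suc m) rewrite +-comm m 1 | +-comm m 3 =
  card-containing-n m , card-OnlyOdd n
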